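{- For every closed term $M:\mathbb N\to\mathbb N$ of $T^{\oplus}$ there exist closed terms $F:\mathbb N\to\mathbb N\to\mathbf{BIN}$ and $Q:\mathbb N\to\mathbb N$ of Gödel's System T such that for every $n\in\mathbb N$: for all $k\in\mathbb N$, $[\![M\,\mathbf n]\!](\mathbf k)$ equals the dyadic rational denoted by the normal form of $F\,\mathbf n\,\mathbf k$, and for all $k\ge$ the normal form of $Q\,\mathbf n$, the normal form of $F\,\mathbf n\,\mathbf k$ denotes $0$.
   Context: Types: $\sigma,\tau::=\mathbb N\mid\sigma\to\tau\mid\sigma\times\tau$. $T^{\oplus}$ terms: $M,N::=x\mid\lambda x.M\mid M\,N\mid\langle M,N\rangle\mid\pi_1\mid\pi_2\mid\mathtt{rec}\mid\mathtt 0\mid\mathtt S\mid M\oplus N$, simply typed with $\mathtt 0:\mathbb N$, $\mathtt S:\mathbb N\to\mathbb N$, $\mathtt{rec}:(\sigma\times(\mathbb N\to\sigma\to\sigma)\times\mathbb N)\to\sigma$, $\pi_1:(\sigma\times\tau)\to\sigma$, $\pi_2:(\sigma\times\tau)\to\tau$, $M\oplus N:\sigma$ if $M,N:\sigma$. Gödel's System T is the fragment without $\oplus$. Numerals $\mathbf 0=\mathtt 0$, $\mathbf{n+1}=\mathtt S\mathbf n$. Values: closed terms of $V,W::=\lambda x.M\mid\pi_1\mid\pi_2\mid\langle V,W\rangle\mid\mathtt{rec}\mid\mathtt 0\mid\mathtt S\mid\mathtt S\,V$. Distributions $\mu:A\to[0,1]$, mass $\le1$; $\{M\}$ Dirac;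 $C[\mu]$ pushforward. Weak call-by-value reduction: $(\lambda x.M)V\to\{M[V/x]\}$; if $M\to\mu$ then $MV\to\mu V$; if $N\to\nu$ then $MN\to M\nu$; pairs left then right; $\mathtt{rec}\langle U,V,\mathtt 0\rangle\to\{U\}$; $\mathtt{rec}\langle U,V,\mathtt S\mathbf n\rangle\to\{V\,\mathbf n\,(\mathtt{rec}\langle U,V,\mathbf n\rangle)\}$; $\pi_i$ project pairs of values; $M\oplus N\to\frac12\{M\}+\frac12\{N\}$; lifted to distributions (reduce reducible support elements, keep values). For closed $M$: $\mu_0=\{M\}$, $\mu_{k+1}$ reduct of $\mu_k$; evaluation $[\![M]\!](V)=\lim_k\mu_k(V)$. $\mathbf{BIN}$ is the type $\mathbb N\times\mathbb N$, a closed normal form $\langle\mathbf m,\mathbf e\rangle$ denoting the dyadic rational $m/2^e$. -}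

module Defs where

open import Data.Nat as ℕ using (ℕ; zero; suc; _≡ᵇ_; _≤_; _^_)
open import Data.Nat.Properties using (m^n≢0)
open import Data.Integer using (+_)
open import Data.Rational using (ℚ; 0ℚ; 1ℚ; ½; _+_; _*_; _-_; _<_; ∣_∣; _/_)
open import Data.Bool using (Bool; true; false; _∧_; if_then_else_)
open import Data.List using (List; []; _∷_; _++_; map)
open import Data.Maybe using (Maybe; just; nothing)
open import Data.Product using (_×_; _,_; Σ; ∃; ∃-syntax)
open import Relation.Binary.PropositionalEquality using (_≡_)

infixr 7 _⇒_
infixr 8 _⊗_

data Ty : Set where
  Nat : Ty
  _⇒_ : Ty → Ty → Ty
  _⊗_ : Ty → Ty → Ty

BIN : Ty
BIN = Nat ⊗ Nat

infixl 9 _·_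
infixr 6 _⊕_

data Term : Set where
  var  : ℕ → Term
  lam  : Term → Term
  _·_  : Term → Term → Term
  pair : Term → Term → Term
  π₁ π₂ recT zeroT sucT : Term
  _⊕_  : Term → Term → Term

infix 4 _⊢_∶_ _∋_∶_

data _∋_∶_ : List Ty → ℕ → Ty → Set where
  here  : ∀ {Γ σ} → (σ ∷ Γ) ∋ zero ∶ σ
  there : ∀ {Γ σ τ i} → Γ ∋ i ∶ σ → (τ ∷ Γ) ∋ suc i ∶ σ

data _⊢_∶_ : List Ty → Term → Ty → Set where
  ⊢var  : ∀ {Γ i σ} → Γ ∋ i ∶ σ → Γ ⊢ var i ∶ σ
  ⊢lam  : ∀ {Γ M σ τ} → (σ ∷ Γ) ⊢ M ∶ τ → Γ ⊢ lam M ∶ σ ⇒ τ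
  ⊢app  : ∀ {Γ M N σ τ} → Γ ⊢ M ∶ σ ⇒ τ → Γ ⊢ N ∶ σ → Γ ⊢ M · N ∶ τ
  ⊢pair : ∀ {Γ M N σ τ} → Γ ⊢ M ∶ σ → Γ ⊢ N ∶ τ → Γ ⊢ pair M N ∶ σ ⊗ τ
  ⊢π₁   : ∀ {Γ σ τ} → Γ ⊢ π₁ ∶ (σ ⊗ τ) ⇒ σ
  ⊢π₂   : ∀ {Γ σ τ} → Γ ⊢ π₂ ∶ (σ ⊗ τ) ⇒ τ
  ⊢rec  : ∀ {Γ σ} → Γ ⊢ recT ∶ (σ ⊗ (Nat ⇒ σ ⇒ σ) ⊗ Nat) ⇒ σ
  ⊢zero : ∀ {Γ} → Γ ⊢ zeroT ∶ Nat
  ⊢suc  : ∀ {Γ} → Γ ⊢ sucT ∶ Nat ⇒ Nat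
  ⊢⊕    : ∀ {Γ M N σ} → Γ ⊢ M ∶ σ → Γ ⊢ N ∶ σ → Γ ⊢ M ⊕ N ∶ σ

data SystemT : Term → Set where
  var  : ∀ i → SystemT (var i)
  lam  : ∀ {M} → SystemT M → SystemT (lam M)
  app  : ∀ {M N} → SystemT M → SystemT N → SystemT (M · N)
  pair : ∀ {M N} → SystemT M → SystemT N → SystemT (pair M N)
  π₁   : SystemT π₁
  π₂   : SystemT π₂
  rec  : SystemT recT
  zer  : SystemT zeroT
  suc  : SystemT sucT

num : ℕ → Term
num zero    = zeroT
num (suc n) = sucT · num n

isValue : Term → Bool
isValue (lam _)    = true
isValue π₁         = true
isValue π₂         = true
isValue (pair V W) = isValue V ∧ isValue W
isValue recT       = true
isValue zeroT      = true
isValue sucT       = true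
isValue (sucT · V) = isValue V
isValue _          = false

-- Substitution of a closed term for index j (no shifting needed since
-- the substituted term is closed)
subst : ℕ → Term → Term → Term
subst j V (var i) with i ℕ.≡ᵇ j | i ℕ.<ᵇ j
... | true  | _     = V
... | false | true  = var i
... | false | false = var (ℕ.pred i)
subst j V (lam M)    = lam (subst (suc j) V M)
subst j V (M · N)    = subst j V M · subst j V N
subst j V (pair M N) = pair (subst j V M) (subst j V N)
subst j V π₁         = π₁
subst j V π₂         = π₂
subst j V recT       = recT
subst j V zeroT      = zeroT
subst j V sucT       = sucT
subst j V (M ⊕ N)    = subst j V M ⊕ subst j V N

-- Finitely supported subdistributions, as weighted lists of terms

Dist : Set
Dist = List (ℚ × Term)

dirac : Term → Dist
dirac t = (1ℚ , t) ∷ []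

mapD : (Term → Term) → Dist → Dist
mapD f = map (λ { (p , t) → (p , f t) })

-- redexes (both components values)
redex : Term → Term → Maybe Dist
redex (lam M) V = just (dirac (subst 0 V M))
redex π₁ (pair V W) = just (dirac V)
redex π₂ (pair V W) = just (dirac W)
redex recT (pair U (pair V zeroT)) = just (dirac U)
redex recT (pair U (pair V (sucT · n))) =
  just (dirac (V · n · (recT · pair U (pair V n))))
redex _ _ = nothing

stepT : Term → Maybe Dist
stepT (M ⊕ N) = just ((½ , M) ∷ (½ , N) ∷ [])
stepT (pair M N) with stepT M
... | just μ  = just (mapD (λ t → pair t N) μ)
... | nothing with isValue M | stepT N
...   | true  | just ν = just (mapD (pair M) ν)
...   | _     | _      = nothing
stepT (M · N) with stepT N
... | just ν  = just (mapD (M ·_) ν)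
... | nothing with isValue N | stepT M
...   | true  | just μ  = just (mapD (_· N) μ)
...   | true  | nothing = if isValue M then redex M N else nothing
...   | false | _       = nothing
stepT _ = nothing

stepD : Dist → Dist
stepD [] = []
stepD ((p , t) ∷ d) with stepT t
... | just μ  = map (λ { (q , s) → (p * q , s) }) μ ++ stepD d
... | nothing = (p , t) ∷ stepD d

μ : Term → ℕ → Dist
μ M zero    = dirac M
μ M (suc k) = stepD (μ M k)

eqT : Term → Term → Bool
eqT (var i) (var j) = i ℕ.≡ᵇ j
eqT (lam M) (lam N) = eqT M N
eqT (M · N) (M' · N') = eqT M M' ∧ eqT N N'
eqT (pair M N) (pair M' N') = eqT M M' ∧ eqT N N'
eqT π₁ π₁ = true
eqT π₂ π₂ = true
eqT recT recT = true
eqT zeroT zeroT = true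
eqT sucT sucT = true
eqT (M ⊕ N) (M' ⊕ N') = eqT M M' ∧ eqT N N'
eqT _ _ = false

mass : Dist → Term → ℚ
mass [] V = 0ℚ
mass ((p , t) ∷ d) V = (if eqT t V then p else 0ℚ) + mass d V

Converges : (ℕ → ℚ) → ℚ → Set
Converges a q = ∀ ε → 0ℚ < ε → ∃[ K ] (∀ k → K ≤ k → ∣ a k - q ∣ < ε)

EvalProb : Term → Term → ℚ → Set
EvalProb M V q = Converges (λ k → mass (μ M k) V) q

-- M reduces (deterministically, for System T) to normal form V
EvalsTo : Term → Term → Set
EvalsTo M V = ∃[ j ] (μ M j ≡ dirac V)

dyadic : ℕ → ℕ → ℚ
dyadic m e = _/_ (+ m) (2 ^ e) {{m^n≢0 2 e}}

{-# OPTIONS --safe #-}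
-- A call-by-value CPS translation with answer type (ℕ → BIN) × ℕ removes ⊕:
-- M ⊕ N passes its continuation to both sides and combines the two answers,
-- averaging the probabilities and adding the bounds.  With the continuation
-- that answers "probability 1 at m, bound m + 1" to the value m, the answer of
-- M n holds the whole distribution of M n and a bound on its support.
-- A logical relation for a set-theoretic semantics of System T identifies the
-- normal form of a System T program with its denotation; a second one relates
-- the reduction tree of M n to the denotation of its CPS translation.
module Submission where

open import Defs
open import Data.Nat using (ℕ; _≤_)
open import Data.Rational using (0ℚ)
open import Data.List using ([])
open import Data.Product using (_×_; ∃-syntax)
open import Relation.Binary.PropositionalEquality using (_≡_)

open import Data.Bool using (Bool; true; false; T; if_then_else_; _∧_)
open import Data.Integer as ℤ using (+_)
import Data.Integer.Properties as ℤₚ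
open import Data.List using (List; _∷_; _++_; length; map)
open import Data.List.Properties using (++-assoc; ++-identityʳ)
open import Data.Maybe using (just; nothing)
open import Data.Nat using (zero; suc; _<_; z≤n; s≤s; _≡ᵇ_; _<ᵇ_; _^_; _⊔_)
import Data.Nat as ℕ
import Data.Nat.Properties as ℕₚ
open import Data.Nat.Tactic.RingSolver using (solve-∀)
open import Data.Product using (_,_; proj₁; proj₂)
open import Data.Rational as ℚ using (ℚ; 1ℚ; ½; _+_; _*_; _-_; ∣_∣; toℚᵘ; _/_)
import Data.Rational.Properties as ℚₚ
open import Data.Rational.Unnormalised as ℚᵘ using (mkℚᵘ; *≡*)
import Data.Rational.Unnormalised.Properties as ℚᵘₚ
open import Data.Unit using (⊤; tt)
open import Relation.Binary.Definitions using (tri<; tri≈; tri>)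
open import Relation.Binary.PropositionalEquality
  using (refl; sym; trans; cong; cong₂; subst₂; module ≡-Reasoning)
  renaming (subst to transport)
open import Relation.Nullary using (yes; no)

-- Closing substitutions

-- Closedness is phrased as invariance under `subst`, the only form in which it is used: `subst`
-- never shifts, so only such terms may be carried under binders.
Closed : Term → Set
Closed V = ∀ j X → subst j X V ≡ V

<ᵇ-true : ∀ {i j} → i < j → (i <ᵇ j) ≡ true
<ᵇ-true {zero}  (s≤s _) = refl
<ᵇ-true {suc i} (s≤s p) = <ᵇ-true p

<ᵇ-false : ∀ {i j} → j ≤ i → (i <ᵇ j) ≡ false
<ᵇ-false z≤n     = refl
<ᵇ-false (s≤s p) = <ᵇ-false p

≡ᵇ-refl : ∀ i → (i ≡ᵇ i) ≡ true
≡ᵇ-refl zero    = refl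
≡ᵇ-refl (suc i) = ≡ᵇ-refl i

<⇒≡ᵇ-false : ∀ {i j} → i < j → (i ≡ᵇ j) ≡ false
<⇒≡ᵇ-false {zero}  (s≤s _) = refl
<⇒≡ᵇ-false {suc i} (s≤s p) = <⇒≡ᵇ-false p

subst-var-< : ∀ {i j} V → i < j → subst j V (var i) ≡ var i
subst-var-< V p rewrite <⇒≡ᵇ-false p | <ᵇ-true p = refl

-- The first d variables are bound; the others are replaced by closed terms,
-- so nothing needs shifting under a binder.
close : ℕ → (ℕ → Term) → Term → Term
close d θ (var i)    = if i <ᵇ d then var i else θ (i ℕ.∸ d)
close d θ (lam M)    = lam (close (suc d) θ M)
close d θ (M · N)    = close d θ M · close d θ N
close d θ (pair M N) = pair (close d θ M) (close d θ N)
close d θ π₁         = π₁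
close d θ π₂         = π₂
close d θ recT       = recT
close d θ zeroT      = zeroT
close d θ sucT       = sucT
close d θ (M ⊕ N)    = close d θ M ⊕ close d θ N

infixr 5 _◂_

_◂_ : Term → (ℕ → Term) → ℕ → Term
(V ◂ θ) zero    = V
(V ◂ θ) (suc i) = θ i

module _ {θ : ℕ → Term} (θ-closed : ∀ i → Closed (θ i)) where

  subst-close : ∀ {d j} X M → d ≤ j → subst j X (close d θ M) ≡ close d θ M
  subst-close {d} X (var i) d≤j with i ℕₚ.<? d
  ... | yes i<d rewrite <ᵇ-true i<d = subst-var-< X (ℕₚ.≤-trans i<d d≤j)
  ... | no  i≮d rewrite <ᵇ-false (ℕₚ.≮⇒≥ i≮d) = θ-closed _ _ X
  subst-close X (lam M)    p = cong lam (subst-close X M (s≤s p))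
  subst-close X (M · N)    p = cong₂ _·_ (subst-close X M p) (subst-close X N p)
  subst-close X (pair M N) p = cong₂ pair (subst-close X M p) (subst-close X N p)
  subst-close X π₁         p = refl
  subst-close X π₂         p = refl
  subst-close X recT       p = refl
  subst-close X zeroT      p = refl
  subst-close X sucT       p = refl
  subst-close X (M ⊕ N)    p = cong₂ _⊕_ (subst-close X M p) (subst-close X N p)

  -- At `d = 0` this shows that a β-contractum is again a closed instance, under the extended
  -- assignment `V ◂ θ`, so the induction hypothesis of a fundamental lemma applies to it.
  subst-close-suc : ∀ d V M → subst d V (close (suc d) θ M) ≡ close d (V ◂ θ) M
  subst-close-suc d V (var i) with ℕₚ.<-cmp i d
  ... | tri< i<d _ _ rewrite <ᵇ-true i<d | <ᵇ-true (ℕₚ.m<n⇒m<1+n i<d) =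
    subst-var-< V i<d
  ... | tri≈ _ refl _
    rewrite <ᵇ-true (ℕₚ.n<1+n i) | ≡ᵇ-refl i | <ᵇ-false (ℕₚ.≤-refl {i})
          | ℕₚ.n∸n≡0 i = refl
  ... | tri> _ _ d<i
    rewrite <ᵇ-false d<i | <ᵇ-false (ℕₚ.<⇒≤ d<i) | ℕₚ.+-∸-assoc 1 d<i =
    θ-closed _ d V
  subst-close-suc d V (lam M)    = cong lam (subst-close-suc (suc d) V M)
  subst-close-suc d V (M · N)    =
    cong₂ _·_ (subst-close-suc d V M) (subst-close-suc d V N)
  subst-close-suc d V (pair M N) =
    cong₂ pair (subst-close-suc d V M) (subst-close-suc d V N)
  subst-close-suc d V π₁         = refl
  subst-close-suc d V π₂         = refl
  subst-close-suc d V recT       = refl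
  subst-close-suc d V zeroT      = refl
  subst-close-suc d V sucT       = refl
  subst-close-suc d V (M ⊕ N)    =
    cong₂ _⊕_ (subst-close-suc d V M) (subst-close-suc d V N)

-- Intrinsically typed terms; ⊕ is available only when b is true, so that
-- Tm true is T⊕ and Tm false is System T.

infixl 9 _∙_

data Tm (b : Bool) (Γ : List Ty) : Ty → Set where
  vr    : ∀ {i σ} → Γ ∋ i ∶ σ → Tm b Γ σ
  ƛ     : ∀ {σ τ} → Tm b (σ ∷ Γ) τ → Tm b Γ (σ ⇒ τ)
  _∙_   : ∀ {σ τ} → Tm b Γ (σ ⇒ τ) → Tm b Γ σ → Tm b Γ τ
  ⟪_,_⟫ : ∀ {σ τ} → Tm b Γ σ → Tm b Γ τ → Tm b Γ (σ ⊗ τ)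
  fst   : ∀ {σ τ} → Tm b Γ ((σ ⊗ τ) ⇒ σ)
  snd   : ∀ {σ τ} → Tm b Γ ((σ ⊗ τ) ⇒ τ)
  prec  : ∀ {σ} → Tm b Γ ((σ ⊗ (Nat ⇒ σ ⇒ σ) ⊗ Nat) ⇒ σ)
  ze    : Tm b Γ Nat
  su    : Tm b Γ (Nat ⇒ Nat)
  toss  : ∀ {σ} → T b → Tm b Γ σ → Tm b Γ σ → Tm b Γ σ

erase : ∀ {b Γ σ} → Tm b Γ σ → Term
erase (vr {i} _)   = var i
erase (ƛ t)        = lam (erase t)
erase (t ∙ u)      = erase t · erase u
erase ⟪ t , u ⟫    = pair (erase t) (erase u)
erase fst          = π₁
erase snd          = π₂
erase prec         = recT
erase ze           = zeroT
erase su           = sucT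
erase (toss _ t u) = erase t ⊕ erase u

⊢erase : ∀ {b Γ σ} (t : Tm b Γ σ) → Γ ⊢ erase t ∶ σ
⊢erase (vr x)       = ⊢var x
⊢erase (ƛ t)        = ⊢lam (⊢erase t)
⊢erase (t ∙ u)      = ⊢app (⊢erase t) (⊢erase u)
⊢erase ⟪ t , u ⟫    = ⊢pair (⊢erase t) (⊢erase u)
⊢erase fst          = ⊢π₁
⊢erase snd          = ⊢π₂
⊢erase prec         = ⊢rec
⊢erase ze           = ⊢zero
⊢erase su           = ⊢suc
⊢erase (toss _ t u) = ⊢⊕ (⊢erase t) (⊢erase u)

erase-systemT : ∀ {Γ σ} (t : Tm false Γ σ) → SystemT (erase t)
erase-systemT (vr x)    = var _
erase-systemT (ƛ t)     = lam (erase-systemT t)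
erase-systemT (t ∙ u)   = app (erase-systemT t) (erase-systemT u)
erase-systemT ⟪ t , u ⟫ = pair (erase-systemT t) (erase-systemT u)
erase-systemT fst       = π₁
erase-systemT snd       = π₂
erase-systemT prec      = rec
erase-systemT ze        = zer
erase-systemT su        = suc

elaborate : ∀ {Γ M σ} → Γ ⊢ M ∶ σ → Tm true Γ σ
elaborate (⊢var x)    = vr x
elaborate (⊢lam D)    = ƛ (elaborate D)
elaborate (⊢app D E)  = elaborate D ∙ elaborate E
elaborate (⊢pair D E) = ⟪ elaborate D , elaborate E ⟫
elaborate ⊢π₁         = fst
elaborate ⊢π₂         = snd
elaborate ⊢rec        = prec
elaborate ⊢zero       = ze
elaborate ⊢suc        = su
elaborate (⊢⊕ D E)    = toss tt (elaborate D) (elaborate E)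

erase-elaborate : ∀ {Γ M σ} (D : Γ ⊢ M ∶ σ) → erase (elaborate D) ≡ M
erase-elaborate (⊢var x)    = refl
erase-elaborate (⊢lam D)    = cong lam (erase-elaborate D)
erase-elaborate (⊢app D E)  = cong₂ _·_ (erase-elaborate D) (erase-elaborate E)
erase-elaborate (⊢pair D E) = cong₂ pair (erase-elaborate D) (erase-elaborate E)
erase-elaborate ⊢π₁         = refl
erase-elaborate ⊢π₂         = refl
erase-elaborate ⊢rec        = refl
erase-elaborate ⊢zero       = refl
erase-elaborate ⊢suc        = refl
erase-elaborate (⊢⊕ D E)    = cong₂ _⊕_ (erase-elaborate D) (erase-elaborate E)

∋⇒< : ∀ {Γ i σ} → Γ ∋ i ∶ σ → i < length Γ
∋⇒< here      = s≤s z≤n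
∋⇒< (there x) = s≤s (∋⇒< x)

-- Typing bounds every free variable by `length Γ`, so `close` finds nothing to replace. For empty
-- `Γ` this removes the closing from the fundamental lemmas.
close-erase : ∀ {b Γ σ} θ (t : Tm b Γ σ) → close (length Γ) θ (erase t) ≡ erase t
close-erase θ (vr x) rewrite <ᵇ-true (∋⇒< x) = refl
close-erase θ (ƛ t)        = cong lam (close-erase θ t)
close-erase θ (t ∙ u)      = cong₂ _·_ (close-erase θ t) (close-erase θ u)
close-erase θ ⟪ t , u ⟫    = cong₂ pair (close-erase θ t) (close-erase θ u)
close-erase θ fst          = refl
close-erase θ snd          = refl
close-erase θ prec         = refl
close-erase θ ze           = refl
close-erase θ su           = refl
close-erase θ (toss _ t u) = cong₂ _⊕_ (close-erase θ t) (close-erase θ u)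

-- One-step reduction in context

record Value (V : Term) : Set where
  constructor value
  field
    is-value : isValue V ≡ true
    closed   : Closed V

open Value

pair-value : ∀ {V W} → Value V → Value W → Value (pair V W)
pair-value (value p cV) (value q cW) =
  value (cong₂ _∧_ p q) λ j X → cong₂ pair (cV j X) (cW j X)

num-value : ∀ n → Value (num n)
num-value zero    = value refl λ j X → refl
num-value (suc n) =
  value (is-value (num-value n)) λ j X → cong (sucT ·_) (closed (num-value n) j X)

∧-split : ∀ {x y} → x ∧ y ≡ true → x ≡ true × y ≡ true
∧-split {true} p = refl , p

isValue⇒stuck : ∀ V → isValue V ≡ true → stepT V ≡ nothing
isValue⇒stuck (lam V) p = refl
isValue⇒stuck π₁      p = refl
isValue⇒stuck π₂      p = refl
isValue⇒stuck recT    p = refl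
isValue⇒stuck zeroT   p = refl
isValue⇒stuck sucT    p = refl
isValue⇒stuck (pair V W) p with ∧-split {isValue V} p
... | pV , pW rewrite isValue⇒stuck V pV | isValue⇒stuck W pW | pV = refl
isValue⇒stuck (sucT · V) p rewrite isValue⇒stuck V p | p = refl

Frame : (Term → Term) → Set
Frame E = ∀ M {ν} → stepT M ≡ just ν → stepT (E M) ≡ just (mapD E ν)

-- `stepT` reduces the argument before the function, so nothing is asked of `M` here, while
-- `frame-fun` needs the argument to be a value.
frame-arg : ∀ M → Frame (M ·_)
frame-arg M N s rewrite s = refl

frame-fun : ∀ {V} → Value V → Frame (_· V)
frame-fun {V} (value p _) M s rewrite isValue⇒stuck V p | p | s = refl

frame-left : ∀ N → Frame (λ M → pair M N)
frame-left N M s rewrite s = refl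

frame-right : ∀ {V} → Value V → Frame (pair V)
frame-right {V} (value p _) M s rewrite isValue⇒stuck V p | p | s = refl

step-redex : ∀ {V W} → Value V → Value W → stepT (V · W) ≡ redex V W
step-redex {V} {W} (value p _) (value q _)
  rewrite isValue⇒stuck W q | q | isValue⇒stuck V p | p = refl

-- Logical relations on values and computations

VRel : Set → Set₁
VRel D = Term → D → Set

IsNum : VRel ℕ
IsNum V n = V ≡ num n

_⁺ : ∀ {D} → VRel D → VRel D
(P ⁺) V d = Value V × P V d

_⊠_ : ∀ {D E} → VRel D → VRel E → VRel (D × E)
(P ⊠ Q) V (a , b) = ∃[ V₁ ] ∃[ V₂ ] (V ≡ pair V₁ V₂ × (P ⁺) V₁ a × (Q ⁺) V₂ b)

infixr 8 _⊠_

-- Arr D E is the denotation of an arrow type, and ap its application in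
-- continuation-passing style.
module Computations
  (b : Bool) (R : Set) (op : R → R → R)
  (Arr : Set → Set → Set) (ap : ∀ {D E} → Arr D E → D → (E → R) → R)
  where

  -- A finite reduction tree of the term whose leaves are values related by `P`, indexed by its
  -- denotation in continuation-passing style. Being inductive, it carries termination; `T b`
  -- confines branching to the probabilistic calculus.
  data Comp {D : Set} (P : VRel D) : Term → ((D → R) → R) → Set where
    ret  : ∀ {V d c} → (P ⁺) V d → (∀ κ → c κ ≡ κ d) → Comp P V c
    det  : ∀ {M M' c} → stepT M ≡ just (dirac M') → Comp P M' c → Comp P M c
    flip : ∀ {M M₁ M₂ c c₁ c₂} → T b →
           stepT M ≡ just ((½ , M₁) ∷ (½ , M₂) ∷ []) →
           Comp P M₁ c₁ → Comp P M₂ c₂ →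
           (∀ κ → c κ ≡ op (c₁ κ) (c₂ κ)) → Comp P M c

  resp : ∀ {D} {P : VRel D} {M c c'} → (∀ κ → c' κ ≡ c κ) → Comp P M c → Comp P M c'
  resp e (ret v q)        = ret v λ κ → trans (e κ) (q κ)
  resp e (det s m)        = det s (resp e m)
  resp e (flip t s m n q) = flip t s m n λ κ → trans (e κ) (q κ)

  -- The tree of `M` is replayed inside the frame, and at each leaf the tree of `C V` is grafted on.
  -- A branching node instantiates its equation at the composite continuation.
  bind : ∀ {D E} {P : VRel D} {Q : VRel E}
         {C M c} {f : D → (E → R) → R} → Frame C → Comp P M c →
         (∀ {V d} → (P ⁺) V d → Comp Q (C V) (f d)) →
         Comp Q (C M) (λ κ → c (λ d → f d κ))
  bind F (ret v q) k        = resp (λ κ → q _) (k v)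
  bind F (det s m) k        = det (F _ s) (bind F m k)
  bind F (flip t s m n q) k = flip t (F _ s) (bind F m k) (bind F n k) λ κ → q _

  infixr 7 _⇛_

  _⇛_ : ∀ {D E} → VRel D → VRel E → VRel (Arr D E)
  (P ⇛ Q) V f = ∀ {W a} → (P ⁺) W a → Comp Q (V · W) (ap f a)

  -- The denotation runs `c'` outermost because the argument is evaluated first.
  comp-app : ∀ {D E} {P : VRel D} {Q : VRel E} {M N c c'} →
             Comp (P ⇛ Q) M c → Comp P N c' →
             Comp Q (M · N) (λ κ → c' (λ a → c (λ f → ap f a κ)))
  comp-app {c = c} m n =
    bind {f = λ a κ → c (λ f → ap f a κ)} (frame-arg _) n λ {_} {a} w →
    bind {f = λ f → ap f a} (frame-fun (proj₁ w)) m λ v → proj₂ v w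

  comp-pair : ∀ {D E} {P : VRel D} {Q : VRel E} {M N c c'} →
              Comp P M c → Comp Q N c' →
              Comp (P ⊠ Q) (pair M N) (λ κ → c (λ a → c' (λ e → κ (a , e))))
  comp-pair {c' = c'} m n =
    bind {f = λ a κ → c' (λ e → κ (a , e))} (frame-left _) m λ {_} {a} v →
    bind {f = λ e κ → κ (a , e)} (frame-right (proj₁ v)) n λ w →
    ret (pair-value (proj₁ v) (proj₁ w) , _ , _ , refl , v , w) λ κ → refl

  comp-⊕ : ∀ {D} {P : VRel D} {M N c c'} → T b → Comp P M c → Comp P N c' →
           Comp P (M ⊕ N) (λ κ → op (c κ) (c' κ))
  comp-⊕ t m n = flip t refl m n λ κ → refl

  lam-⇛ : ∀ {D E} {P : VRel D} {Q : VRel E} {M f} → Closed (lam M) →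
          (∀ {V a} → (P ⁺) V a → Comp Q (subst 0 V M) (ap f a)) →
          ((P ⇛ Q) ⁺) (lam M) f
  lam-⇛ {M = M} cM k = value refl cM , λ v →
    det (step-redex {lam M} (value refl cM) (proj₁ v)) (k v)

  π₁-⇛ : ∀ {D E} {P : VRel D} {Q : VRel E} {f} →
         (∀ p κ → ap f p κ ≡ κ (proj₁ p)) → (((P ⊠ Q) ⇛ P) ⁺) π₁ f
  π₁-⇛ e = v₀ , λ { (w , _ , _ , refl , v₁ , v₂) →
    det (step-redex v₀ w) (ret v₁ (e _)) }
    where
    v₀ : Value π₁
    v₀ = value refl λ _ _ → refl

  π₂-⇛ : ∀ {D E} {P : VRel D} {Q : VRel E} {f} →
         (∀ p κ → ap f p κ ≡ κ (proj₂ p)) → (((P ⊠ Q) ⇛ Q) ⁺) π₂ f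
  π₂-⇛ e = v₀ , λ { (w , _ , _ , refl , v₁ , v₂) →
    det (step-redex v₀ w) (ret v₂ (e _)) }
    where
    v₀ : Value π₂
    v₀ = value refl λ _ _ → refl

  suc-⇛ : ∀ {f} → (∀ n κ → ap f n κ ≡ κ (suc n)) → ((IsNum ⇛ IsNum) ⁺) sucT f
  suc-⇛ e = value refl (λ _ _ → refl) ,
    λ { {a = n} (_ , refl) → ret (num-value (suc n) , refl) (e n) }

  module _ {D : Set} {P : VRel D} {f : Arr (D × Arr ℕ (Arr D D) × ℕ) D}
    (f-zero : ∀ u v κ → ap f (u , v , 0) κ ≡ κ u)
    (f-suc : ∀ u v n κ → ap f (u , v , suc n) κ ≡
       ap f (u , v , n) (λ w → ap v n (λ g → ap g w κ)))
    where

    rec-value : Value recT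
    rec-value = value refl λ _ _ → refl

    -- Induction on `n`: a successor unfolds to `V` applied to the numeral and then to the recursive
    -- call, so `comp-app` combines the relation for `V` with the induction hypothesis. Running the
    -- recursive call first is the order fixed by `f-suc`.
    rec-num : ∀ {U V u v} → (P ⁺) U u → ((IsNum ⇛ P ⇛ P) ⁺) V v → ∀ n →
              Comp P (recT · pair U (pair V (num n))) (ap f (u , v , n))
    rec-num {U} {V} uU vV zero =
      det (step-redex rec-value
            (pair-value (proj₁ uU) (pair-value (proj₁ vV) (num-value 0))))
        (ret uU (f-zero _ _))
    rec-num {U} {V} uU vV (suc n) =
      det (step-redex rec-value
            (pair-value (proj₁ uU) (pair-value (proj₁ vV) (num-value (suc n)))))
        (resp (f-suc _ _ n)
          (comp-app (proj₂ vV (num-value n , refl)) (rec-num uU vV n)))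

    rec-⇛ : (((P ⊠ (IsNum ⇛ P ⇛ P) ⊠ IsNum) ⇛ P) ⁺) recT f
    rec-⇛ = rec-value ,
      λ { (_ , _ , _ , refl , uU , _ , _ , _ , refl , vV , _ , refl) → rec-num uU vV _ }

-- Denotational semantics and adequacy of System T

⟦_⟧ : Ty → Set
⟦ Nat ⟧   = ℕ
⟦ σ ⇒ τ ⟧ = ⟦ σ ⟧ → ⟦ τ ⟧
⟦ σ ⊗ τ ⟧ = ⟦ σ ⟧ × ⟦ τ ⟧

Env : List Ty → Set
Env []      = ⊤
Env (σ ∷ Γ) = ⟦ σ ⟧ × Env Γ

lookup : ∀ {Γ i σ} → Γ ∋ i ∶ σ → Env Γ → ⟦ σ ⟧
lookup here      (a , ρ) = a
lookup (there x) (a , ρ) = lookup x ρ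

primrec : {A : Set} → A → (ℕ → A → A) → ℕ → A
primrec u v zero    = u
primrec u v (suc n) = v n (primrec u v n)

eval : ∀ {Γ σ} → Tm false Γ σ → Env Γ → ⟦ σ ⟧
eval (vr x)    ρ = lookup x ρ
eval (ƛ t)     ρ = λ a → eval t (a , ρ)
eval (t ∙ u)   ρ = eval t ρ (eval u ρ)
eval ⟪ t , u ⟫ ρ = eval t ρ , eval u ρ
eval fst       ρ = proj₁
eval snd       ρ = proj₂
eval prec      ρ = λ (u , v , n) → primrec u v n
eval ze        ρ = 0
eval su        ρ = suc

module SystemTAdequacy (R : Set) where

  open Computations false R (λ x _ → x) (λ D E → D → E) (λ f a κ → κ (f a)) public

  Rel : ∀ σ → VRel ⟦ σ ⟧
  Rel Nat     = IsNum
  Rel (σ ⇒ τ) = Rel σ ⇛ Rel τ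
  Rel (σ ⊗ τ) = Rel σ ⊠ Rel τ

  Close : ∀ Γ → (ℕ → Term) → Env Γ → Set
  Close Γ θ ρ = ∀ {i σ} (x : Γ ∋ i ∶ σ) → ((Rel σ) ⁺) (θ i) (lookup x ρ)

  fundamental : ∀ {Γ σ} (t : Tm false Γ σ) {θ ρ} → (∀ i → Closed (θ i)) → Close Γ θ ρ →
                Comp (Rel σ) (close 0 θ (erase t)) (λ κ → κ (eval t ρ))
  fundamental (vr x)          cθ r = ret (r x) λ κ → refl
  fundamental {Γ} (ƛ {σ} t) {θ} {ρ} cθ r =
    ret (lam-⇛ (λ j X → subst-close cθ X (lam (erase t)) z≤n) body) λ κ → refl
    where
    body : ∀ {V a} → (Rel σ ⁺) V a →
           Comp (Rel _) (subst 0 V (close 1 θ (erase t))) (λ κ → κ (eval t (a , ρ)))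
    body {V} {a} v rewrite subst-close-suc cθ 0 V (erase t) =
      fundamental t (λ { zero → closed (proj₁ v) ; (suc i) → cθ i })
        λ { here → v ; (there x) → r x }
  fundamental (t ∙ u)         cθ r = comp-app (fundamental t cθ r) (fundamental u cθ r)
  fundamental ⟪ t , u ⟫       cθ r = comp-pair (fundamental t cθ r) (fundamental u cθ r)
  fundamental fst             cθ r = ret (π₁-⇛ λ _ _ → refl) λ κ → refl
  fundamental snd             cθ r = ret (π₂-⇛ λ _ _ → refl) λ κ → refl
  fundamental prec            cθ r =
    ret (rec-⇛ (λ _ _ _ → refl) λ _ _ _ _ → refl) λ κ → refl
  fundamental ze              cθ r = ret (num-value 0 , refl) λ κ → refl
  fundamental su              cθ r = ret (suc-⇛ λ _ _ → refl) λ κ → refl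

stepD-dirac : ∀ {M M'} → stepT M ≡ just (dirac M') → stepD (dirac M) ≡ dirac M'
stepD-dirac s rewrite s = refl

-- `μ` adds steps at the end, whereas induction on a reduction tree needs the first step peeled off.
μ-head : ∀ {M M'} → stepT M ≡ just (dirac M') → ∀ j → μ M (suc j) ≡ μ M' j
μ-head {M} s zero    = stepD-dirac {M} s
μ-head s (suc j) = cong stepD (μ-head s j)

-- Taking the answer type to be the type of values lets the identity
-- continuation read off the denotation of the value reached.
adequacy : ∀ {σ} (t : Tm false [] σ) → let open SystemTAdequacy ⟦ σ ⟧ in
           ∃[ V ] (EvalsTo (erase t) V × Rel σ V (eval t tt))
adequacy {σ} t = transport (λ M → ∃[ V ] (EvalsTo M V × Rel σ V (eval t tt)))
  (close-erase (λ _ → zeroT) t)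
  (run (fundamental t (λ _ _ _ → refl) λ ()))
  where
  open SystemTAdequacy ⟦ σ ⟧
  run : ∀ {M c} → Comp (Rel σ) M c → ∃[ V ] (EvalsTo M V × Rel σ V (c λ d → d))
  run {M} (ret v q) rewrite q (λ d → d) = M , (0 , refl) , proj₂ v
  run (det s m) with run m
  ... | V , (j , e) , r = V , (suc j , trans (μ-head s j) e) , r
  run (flip () _ _ _ _)

-- Translation of T⊕ into System T in continuation-passing style

-- The first component of an answer maps k to the dyadic probability of the
-- numeral k; the second is larger than every number of positive probability.
Ans : Ty
Ans = (Nat ⇒ BIN) ⊗ Nat

⌈_⌉ : Ty → Ty
⌈ Nat ⌉   = Nat
⌈ σ ⇒ τ ⌉ = ⌈ σ ⌉ ⇒ (⌈ τ ⌉ ⇒ Ans) ⇒ Ans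
⌈ σ ⊗ τ ⌉ = ⌈ σ ⌉ ⊗ ⌈ τ ⌉

Cps : Ty → Ty
Cps σ = (σ ⇒ Ans) ⇒ Ans

pattern v0 = vr here
pattern v1 = vr (there here)
pattern v2 = vr (there (there here))
pattern v3 = vr (there (there (there here)))

addT : ∀ {Γ} → Tm false Γ Nat → Tm false Γ Nat → Tm false Γ Nat
addT t u = prec ∙ ⟪ u , ⟪ ƛ (ƛ (su ∙ v0)) , t ⟫ ⟫

-- Doubling `t` in each of `u` rounds gives the product of `t` and `2 ^ u`.
shiftT : ∀ {Γ} → Tm false Γ Nat → Tm false Γ Nat → Tm false Γ Nat
shiftT t u = prec ∙ ⟪ t , ⟪ ƛ (ƛ (addT v0 v0)) , u ⟫ ⟫

-- The half-sum of m/2^e and m'/2^e' over the common denominator 2^(e+e'+1), without cancelling.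
averageT : ∀ {Γ} → Tm false Γ BIN → Tm false Γ BIN → Tm false Γ BIN
averageT t u =
  ⟪ addT (shiftT (fst ∙ t) (snd ∙ u)) (shiftT (fst ∙ u) (snd ∙ t))
  , su ∙ addT (snd ∙ t) (snd ∙ u) ⟫

-- Recursion on the first number builds a test function of the second: the base case tests for zero,
-- and the step answers `ze` at zero and otherwise calls the previous test (`v3`) on the predecessor
-- (`v1`).
equalT : ∀ {Γ} → Tm false Γ (Nat ⇒ Nat ⇒ Nat)
equalT = ƛ (prec ∙ ⟪ ƛ (prec ∙ ⟪ su ∙ ze , ⟪ ƛ (ƛ ze) , v0 ⟫ ⟫)
                   , ⟪ ƛ (ƛ (ƛ (prec ∙ ⟪ ze , ⟪ ƛ (ƛ (v3 ∙ v1)) , v0 ⟫ ⟫))) , v0 ⟫ ⟫)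

mergeT : ∀ {Γ} → Tm false Γ (Ans ⇒ Ans ⇒ Ans)
mergeT = ƛ (ƛ ⟪ ƛ (averageT (fst ∙ v2 ∙ v0) (fst ∙ v1 ∙ v0)) , addT (snd ∙ v1) (snd ∙ v0) ⟫)

returnT : ∀ {Γ σ} → Tm false Γ (σ ⇒ Cps σ)
returnT = ƛ (ƛ (v0 ∙ v1))

-- The argument's computation runs before the function's, as in the reduction strategy and in
-- `comp-app`.
applyT : ∀ {Γ σ τ} → Tm false Γ (Cps (σ ⇒ Cps τ) ⇒ Cps σ ⇒ Cps τ)
applyT = ƛ (ƛ (ƛ (v1 ∙ ƛ (v3 ∙ ƛ (v0 ∙ v1 ∙ v2)))))

pairT : ∀ {Γ σ τ} → Tm false Γ (Cps σ ⇒ Cps τ ⇒ Cps (σ ⊗ τ))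
pairT = ƛ (ƛ (ƛ (v2 ∙ ƛ (v2 ∙ ƛ (v2 ∙ ⟪ v1 , v0 ⟫)))))

tossT : ∀ {Γ σ} → Tm false Γ (Cps σ ⇒ Cps σ ⇒ Cps σ)
tossT = ƛ (ƛ (ƛ (mergeT ∙ (v2 ∙ v0) ∙ (v1 ∙ v0))))

-- The recursion accumulates computations rather than values, so the choices made in a recursive
-- call are passed on through its continuation.
precT : ∀ {Γ} σ → Tm false Γ ⌈ (σ ⊗ (Nat ⇒ σ ⇒ σ) ⊗ Nat) ⇒ σ ⌉
precT σ = ƛ (prec ∙ ⟪ returnT ∙ (fst ∙ v0)
                    , ⟪ ƛ (ƛ (applyT ∙ (fst ∙ (snd ∙ v2) ∙ v1) ∙ v0))
                      , snd ∙ (snd ∙ v0) ⟫ ⟫)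

⌈_⌉∋ : ∀ {Γ i σ} → Γ ∋ i ∶ σ → map ⌈_⌉ Γ ∋ i ∶ ⌈ σ ⌉
⌈ here ⌉∋    = here
⌈ there x ⌉∋ = there ⌈ x ⌉∋

-- The translation uses closed combinators, so that no subterm is ever weakened.
cps : ∀ {Γ σ} → Tm true Γ σ → Tm false (map ⌈_⌉ Γ) (Cps ⌈ σ ⌉)
cps (vr x)            = returnT ∙ vr ⌈ x ⌉∋
cps (ƛ t)             = returnT ∙ ƛ (cps t)
cps (t ∙ u)           = applyT ∙ cps t ∙ cps u
cps ⟪ t , u ⟫         = pairT ∙ cps t ∙ cps u
cps fst               = returnT ∙ ƛ (returnT ∙ (fst ∙ v0))
cps snd               = returnT ∙ ƛ (returnT ∙ (snd ∙ v0))
cps (prec {σ})        = returnT ∙ precT σ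
cps ze                = returnT ∙ ze
cps su                = returnT ∙ ƛ (returnT ∙ (su ∙ v0))
cps (toss _ t u)      = tossT ∙ cps t ∙ cps u

-- Correctness of the translation

merge : ⟦ Ans ⟧ → ⟦ Ans ⟧ → ⟦ Ans ⟧
merge = eval {[]} mergeT tt

open Computations true ⟦ Ans ⟧ merge (λ D E → D → (E → ⟦ Ans ⟧) → ⟦ Ans ⟧) (λ f → f)

Rel : ∀ σ → VRel ⟦ ⌈ σ ⌉ ⟧
Rel Nat     = IsNum
Rel (σ ⇒ τ) = Rel σ ⇛ Rel τ
Rel (σ ⊗ τ) = Rel σ ⊠ Rel τ

Close : ∀ Γ → (ℕ → Term) → Env (map ⌈_⌉ Γ) → Set
Close Γ θ ρ = ∀ {i σ} (x : Γ ∋ i ∶ σ) → (Rel σ ⁺) (θ i) (lookup ⌈ x ⌉∋ ρ)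

-- In every case `eval (cps t) ρ` unfolds definitionally to the denotation produced by the matching
-- combinator of `Comp`, so each remaining equation is `refl`.
cps-fundamental : ∀ {Γ σ} (t : Tm true Γ σ) {θ ρ} → (∀ i → Closed (θ i)) → Close Γ θ ρ →
                  Comp (Rel σ) (close 0 θ (erase t)) (eval (cps t) ρ)
cps-fundamental (vr x)       cθ r = ret (r x) λ κ → refl
cps-fundamental (ƛ {σ} t) {θ} {ρ} cθ r =
  ret (lam-⇛ (λ j X → subst-close cθ X (lam (erase t)) z≤n) body) λ κ → refl
  where
  body : ∀ {V a} → (Rel σ ⁺) V a →
         Comp (Rel _) (subst 0 V (close 1 θ (erase t))) (eval (cps t) (a , ρ))
  body {V} {a} v rewrite subst-close-suc cθ 0 V (erase t) =
    cps-fundamental t (λ { zero → closed (proj₁ v) ; (suc i) → cθ i })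
      λ { here → v ; (there x) → r x }
cps-fundamental (t ∙ u)      cθ r = comp-app (cps-fundamental t cθ r) (cps-fundamental u cθ r)
cps-fundamental ⟪ t , u ⟫    cθ r = comp-pair (cps-fundamental t cθ r) (cps-fundamental u cθ r)
cps-fundamental fst          cθ r = ret (π₁-⇛ λ _ _ → refl) λ κ → refl
cps-fundamental snd          cθ r = ret (π₂-⇛ λ _ _ → refl) λ κ → refl
cps-fundamental prec         cθ r =
  ret (rec-⇛ (λ _ _ _ → refl) λ _ _ _ _ → refl) λ κ → refl
cps-fundamental ze           cθ r = ret (num-value 0 , refl) λ κ → refl
cps-fundamental su           cθ r = ret (suc-⇛ λ _ _ → refl) λ κ → refl
cps-fundamental (toss _ t u) cθ r =
  comp-⊕ tt (cps-fundamental t cθ r) (cps-fundamental u cθ r)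

-- Arithmetic of dyadic rationals

-- This is the cross-multiplied form of the equality in `fraction-average`. All quantities are
-- natural numbers, so it reduces to a semiring identity in ℕ followed by casts.
cross-multiplied : ∀ m m' d d' D → D ≡ 2 ℕ.* (d ℕ.* d') →
  + (d' ℕ.* m ℕ.+ d ℕ.* m') ℤ.* + ((2 ℕ.* d) ℕ.* (2 ℕ.* d')) ≡
  ((+ 1 ℤ.* + m) ℤ.* + (2 ℕ.* d') ℤ.+ (+ 1 ℤ.* + m') ℤ.* + (2 ℕ.* d)) ℤ.* + D
cross-multiplied m m' d d' D refl = begin
  + (d' ℕ.* m ℕ.+ d ℕ.* m') ℤ.* + ((2 ℕ.* d) ℕ.* (2 ℕ.* d'))
    ≡⟨ sym (ℤₚ.pos-* (d' ℕ.* m ℕ.+ d ℕ.* m') _) ⟩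
  + ((d' ℕ.* m ℕ.+ d ℕ.* m') ℕ.* ((2 ℕ.* d) ℕ.* (2 ℕ.* d')))
    ≡⟨ cong +_ (identity m m' d d') ⟩
  + (((1 ℕ.* m) ℕ.* (2 ℕ.* d') ℕ.+ (1 ℕ.* m') ℕ.* (2 ℕ.* d)) ℕ.* D)
    ≡⟨ ℤₚ.pos-* ((1 ℕ.* m) ℕ.* (2 ℕ.* d') ℕ.+ (1 ℕ.* m') ℕ.* (2 ℕ.* d)) D ⟩
  + ((1 ℕ.* m) ℕ.* (2 ℕ.* d') ℕ.+ (1 ℕ.* m') ℕ.* (2 ℕ.* d)) ℤ.* + D
    ≡⟨ cong (ℤ._* + D) (cong₂ ℤ._+_ (cast m (2 ℕ.* d')) (cast m' (2 ℕ.* d))) ⟩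
  ((+ 1 ℤ.* + m) ℤ.* + (2 ℕ.* d') ℤ.+ (+ 1 ℤ.* + m') ℤ.* + (2 ℕ.* d)) ℤ.* + D
    ∎
  where
  open ≡-Reasoning
  identity : ∀ m m' d d' →
    (d' ℕ.* m ℕ.+ d ℕ.* m') ℕ.* ((2 ℕ.* d) ℕ.* (2 ℕ.* d')) ≡
    ((1 ℕ.* m) ℕ.* (2 ℕ.* d') ℕ.+ (1 ℕ.* m') ℕ.* (2 ℕ.* d)) ℕ.* (2 ℕ.* (d ℕ.* d'))
  identity = solve-∀
  cast : ∀ x y → + ((1 ℕ.* x) ℕ.* y) ≡ (+ 1 ℤ.* + x) ℤ.* + y
  cast x y = trans (ℤₚ.pos-* (1 ℕ.* x) y) (cong (ℤ._* + y) (ℤₚ.pos-* 1 x))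

-- Passing to unnormalised rationals avoids reduction to lowest terms and leaves only a
-- cross-multiplication.
fraction-average : ∀ m m' d d' D
  .{{_ : ℕ.NonZero d}} .{{_ : ℕ.NonZero d'}} .{{_ : ℕ.NonZero D}} →
  D ≡ 2 ℕ.* (d ℕ.* d') →
  + (d' ℕ.* m ℕ.+ d ℕ.* m') / D ≡ ½ * (+ m / d) + ½ * (+ m' / d')
fraction-average m m' d@(suc a) d'@(suc b) D@(suc c) eq = ℚₚ.toℚᵘ-injective (begin
  toℚᵘ (+ N / D)                                            ≈⟨ ℚₚ.toℚᵘ-fromℚᵘ (mkℚᵘ (+ N) c) ⟩
  mkℚᵘ (+ N) c                                              ≈⟨ *≡* (cross-multiplied m m' d d' D eq) ⟩
  ℚᵘ.½ ℚᵘ.* mkℚᵘ (+ m) a ℚᵘ.+ ℚᵘ.½ ℚᵘ.* mkℚᵘ (+ m') b       ≈⟨ ℚᵘₚ.+-cong (half m a) (half m' b) ⟨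
  toℚᵘ (½ * (+ m / d)) ℚᵘ.+ toℚᵘ (½ * (+ m' / d'))          ≈⟨ ℚₚ.toℚᵘ-homo-+ (½ * (+ m / d)) (½ * (+ m' / d')) ⟨
  toℚᵘ (½ * (+ m / d) + ½ * (+ m' / d'))                    ∎)
  where
  open ℚᵘₚ.≃-Reasoning
  N : ℕ
  N = d' ℕ.* m ℕ.+ d ℕ.* m'
  half : ∀ m a → toℚᵘ (½ * (+ m / suc a)) ℚᵘ.≃ ℚᵘ.½ ℚᵘ.* mkℚᵘ (+ m) a
  half m a = ℚᵘₚ.≃-trans (ℚₚ.toℚᵘ-homo-* ½ (+ m / suc a))
    (ℚᵘₚ.*-congˡ {ℚᵘ.½} (ℚₚ.toℚᵘ-fromℚᵘ (mkℚᵘ (+ m) a)))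

primrec-+ : ∀ m n → primrec n (λ _ → suc) m ≡ m ℕ.+ n
primrec-+ zero    n = refl
primrec-+ (suc m) n = cong suc (primrec-+ m n)

primrec-shift : ∀ m e → primrec m (λ _ x → primrec x (λ _ → suc) x) e ≡ 2 ^ e ℕ.* m
primrec-shift m zero    = sym (ℕₚ.+-identityʳ m)
primrec-shift m (suc e) = begin
  primrec x (λ _ → suc) x  ≡⟨ primrec-+ x x ⟩
  x ℕ.+ x                  ≡⟨ cong (λ y → y ℕ.+ y) (primrec-shift m e) ⟩
  y ℕ.+ y                  ≡⟨ cong (y ℕ.+_) (sym (ℕₚ.+-identityʳ y)) ⟩
  2 ℕ.* y                  ≡⟨ sym (ℕₚ.*-assoc 2 (2 ^ e) m) ⟩
  2 ^ suc e ℕ.* m          ∎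
  where
  open ≡-Reasoning
  x y : ℕ
  x = primrec m (λ _ x → primrec x (λ _ → suc) x) e
  y = 2 ^ e ℕ.* m

average : ⟦ BIN ⟧ → ⟦ BIN ⟧ → ⟦ BIN ⟧
average x y = eval {BIN ∷ BIN ∷ []} (averageT v0 v1) (x , y , tt)

dyadic-average : ∀ m e m' e' → let (n , i) = average (m , e) (m' , e') in
  dyadic n i ≡ ½ * dyadic m e + ½ * dyadic m' e'
dyadic-average m e m' e' = trans
  (cong₂ dyadic
    (trans (primrec-+ (primrec m (λ _ x → primrec x (λ _ → suc) x) e') _)
           (cong₂ ℕ._+_ (primrec-shift m e') (primrec-shift m' e)))
    (cong suc (primrec-+ e e')))
  (fraction-average m m' (2 ^ e) (2 ^ e') (2 ^ suc (e ℕ.+ e'))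
    {{ℕₚ.m^n≢0 2 e}} {{ℕₚ.m^n≢0 2 e'}} {{ℕₚ.m^n≢0 2 (suc (e ℕ.+ e'))}}
    (cong (2 ℕ.*_) (ℕₚ.^-distribˡ-+-* 2 e e')))

-- Limits of the reduction sequence

-- Iterates from the front and from any distribution, so that the first step can be exposed and the
-- branches followed separately.
steps : ℕ → Dist → Dist
steps zero    d = d
steps (suc k) d = steps k (stepD d)

stepD-steps : ∀ k d → stepD (steps k d) ≡ steps k (stepD d)
stepD-steps zero    d = refl
stepD-steps (suc k) d = stepD-steps k (stepD d)

μ≡steps : ∀ M k → μ M k ≡ steps k (dirac M)
μ≡steps M zero    = refl
μ≡steps M (suc k) = trans (cong stepD (μ≡steps M k)) (stepD-steps k (dirac M))

stepD-++ : ∀ d d' → stepD (d ++ d') ≡ stepD d ++ stepD d'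
stepD-++ []            d' = refl
stepD-++ ((p , t) ∷ d) d' with stepT t
... | just ν  = trans (cong (ν' ++_) (stepD-++ d d')) (sym (++-assoc ν' (stepD d) (stepD d')))
  where
  ν' : Dist
  ν' = map (λ { (q , s) → p * q , s }) ν
... | nothing = cong ((p , t) ∷_) (stepD-++ d d')

steps-++ : ∀ k d d' → steps k (d ++ d') ≡ steps k d ++ steps k d'
steps-++ zero    d d' = refl
steps-++ (suc k) d d' =
  trans (cong (steps k) (stepD-++ d d')) (steps-++ k (stepD d) (stepD d'))

mass-++ : ∀ d d' V → mass (d ++ d') V ≡ mass d V + mass d' V
mass-++ []            d' V = sym (ℚₚ.+-identityˡ _)
mass-++ ((p , t) ∷ d) d' V =
  trans (cong (_+_ x) (mass-++ d d' V)) (sym (ℚₚ.+-assoc x (mass d V) (mass d' V)))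
  where
  x : ℚ
  x = if eqT t V then p else 0ℚ

steps-stuck : ∀ {M} → stepT M ≡ nothing → ∀ k p → steps k ((p , M) ∷ []) ≡ (p , M) ∷ []
steps-stuck s zero    p = refl
steps-stuck {M} s (suc k) p rewrite s = steps-stuck {M} s k p

stepD-just : ∀ {M ν} → stepT M ≡ just ν → ∀ p →
             stepD ((p , M) ∷ []) ≡ map (λ (q , N) → p * q , N) ν
stepD-just {M} s p rewrite s = ++-identityʳ _

eqT-num : ∀ m n → eqT (num m) (num n) ≡ (m ≡ᵇ n)
eqT-num zero    zero    = refl
eqT-num zero    (suc n) = refl
eqT-num (suc m) zero    = refl
eqT-num (suc m) (suc n) = eqT-num m n

mass-num : ∀ n j p → mass ((p , num n) ∷ []) (num j) ≡ p * (if n ≡ᵇ j then 1ℚ else 0ℚ)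
mass-num n j p rewrite eqT-num n j with n ≡ᵇ j
... | true  = trans (ℚₚ.+-identityʳ p) (sym (ℚₚ.*-identityʳ p))
... | false = sym (ℚₚ.*-zeroʳ p)

-- Answers and the limit masses they represent

eval-equalT : ∀ {Γ} (ρ : Env Γ) m n → eval equalT ρ m n ≡ (if m ≡ᵇ n then 1 else 0)
eval-equalT ρ zero    zero    = refl
eval-equalT ρ zero    (suc n) = refl
eval-equalT ρ (suc m) zero    = refl
eval-equalT ρ (suc m) (suc n) = eval-equalT ρ m n

leafT : ∀ {Γ} → Tm false Γ (Nat ⇒ Ans)
leafT = ƛ ⟪ ƛ ⟪ equalT ∙ v1 ∙ v0 , ze ⟫ , su ∙ v0 ⟫

leaf : ℕ → ⟦ Ans ⟧
leaf = eval {[]} leafT tt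

module _ (j : ℕ) where

  infix 4 _≈ᵃ_

  record _≈ᵃ_ (r : ⟦ Ans ⟧) (x : ℚ) : Set where
    constructor represents
    field
      dyadic-value : dyadic (proj₁ (proj₁ r j)) (proj₂ (proj₁ r j)) ≡ x
      vanishing    : proj₂ r ≤ j → x ≡ 0ℚ

  leaf-≈ᵃ : ∀ n → leaf n ≈ᵃ (if n ≡ᵇ j then 1ℚ else 0ℚ)
  -- The bound of `leaf n` is `suc n`, so lying at or above it means `n < j`.
  leaf-≈ᵃ n = represents dyadic-leaf λ n<j → cong (if_then 1ℚ else 0ℚ) (<⇒≡ᵇ-false n<j)
    where
    dyadic-leaf : dyadic (proj₁ (proj₁ (leaf n) j)) 0 ≡ (if n ≡ᵇ j then 1ℚ else 0ℚ)
    dyadic-leaf rewrite eval-equalT (j , n , tt) n j with n ≡ᵇ j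
    ... | true  = refl
    ... | false = refl

  merge-≈ᵃ : ∀ r s {x y} → r ≈ᵃ x → s ≈ᵃ y → merge r s ≈ᵃ ½ * x + ½ * y
  merge-≈ᵃ r s (represents refl z) (represents refl z') = represents
    (dyadic-average (proj₁ (proj₁ r j)) (proj₂ (proj₁ r j))
                    (proj₁ (proj₁ s j)) (proj₂ (proj₁ s j)))
    -- The sum of the two bounds dominates each of them, so both probabilities vanish beyond it.
    λ le → let le' = transport (_≤ j) (primrec-+ (proj₂ r) (proj₂ s)) le in
      cong₂ (λ x y → ½ * x + ½ * y)
        (z (ℕₚ.≤-trans (ℕₚ.m≤m+n _ _) le')) (z' (ℕₚ.≤-trans (ℕₚ.m≤n+m _ _) le'))

  -- The weight `p` is arbitrary because a choice passes half of its weight to each branch; `K` does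
  -- not depend on `p`.
  Eventual : Term → ⟦ Ans ⟧ → Set
  Eventual M r = ∃[ x ] (r ≈ᵃ x × ∃[ K ]
    (∀ k → K ≤ k → ∀ p → mass (steps k ((p , M) ∷ [])) (num j) ≡ p * x))

  eventual-num : ∀ n → Eventual (num n) (leaf n)
  eventual-num n = (if n ≡ᵇ j then 1ℚ else 0ℚ) , leaf-≈ᵃ n , 0 , λ k _ p → trans
    (cong (λ d → mass d (num j))
      (steps-stuck {num n} (isValue⇒stuck (num n) (is-value (num-value n))) k p))
    (mass-num n j p)

  eventual-det : ∀ {M M' r} → stepT M ≡ just (dirac M') → Eventual M' r → Eventual M r
  eventual-det {M} {M'} s (x , a , K , lim) =
    x , a , suc K , λ { (suc k) (s≤s K≤k) p → step k K≤k p }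
    where
    open ≡-Reasoning
    step : ∀ k → K ≤ k → ∀ p → mass (steps k (stepD ((p , M) ∷ []))) (num j) ≡ p * x
    step k K≤k p = begin
      mass (steps k (stepD ((p , M) ∷ []))) (num j)
        ≡⟨ cong (λ d → mass (steps k d) (num j)) (stepD-just {M} s p) ⟩
      mass (steps k ((p * 1ℚ , M') ∷ [])) (num j)
        ≡⟨ lim k K≤k (p * 1ℚ) ⟩
      p * 1ℚ * x
        ≡⟨ cong (_* x) (ℚₚ.*-identityʳ p) ⟩
      p * x ∎

  -- The two branches evolve independently, so their masses add. The threshold waits for both
  -- branches, plus one step for the choice itself.
  eventual-flip : ∀ {M M₁ M₂ r₁ r₂} → stepT M ≡ just ((½ , M₁) ∷ (½ , M₂) ∷ []) →
                  Eventual M₁ r₁ → Eventual M₂ r₂ → Eventual M (merge r₁ r₂)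
  eventual-flip {M} {M₁} {M₂} {r₁} {r₂} s (x₁ , a₁ , K₁ , lim₁) (x₂ , a₂ , K₂ , lim₂) =
    ½ * x₁ + ½ * x₂ , merge-≈ᵃ r₁ r₂ a₁ a₂ , suc (K₁ ⊔ K₂) ,
    λ { (suc k) (s≤s K≤k) p → step k (ℕₚ.m⊔n≤o⇒m≤o K₁ K₂ K≤k) (ℕₚ.m⊔n≤o⇒n≤o K₁ K₂ K≤k) p }
    where
    open ≡-Reasoning
    step : ∀ k → K₁ ≤ k → K₂ ≤ k → ∀ p →
           mass (steps k (stepD ((p , M) ∷ []))) (num j) ≡ p * (½ * x₁ + ½ * x₂)
    step k le₁ le₂ p = begin
      mass (steps k (stepD ((p , M) ∷ []))) (num j)
        ≡⟨ cong (λ d → mass (steps k d) (num j)) (stepD-just {M} s p) ⟩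
      mass (steps k ((p * ½ , M₁) ∷ (p * ½ , M₂) ∷ [])) (num j)
        ≡⟨ cong (λ d → mass d (num j))
             (steps-++ k ((p * ½ , M₁) ∷ []) ((p * ½ , M₂) ∷ [])) ⟩
      mass (steps k ((p * ½ , M₁) ∷ []) ++ steps k ((p * ½ , M₂) ∷ [])) (num j)
        ≡⟨ mass-++ (steps k ((p * ½ , M₁) ∷ [])) (steps k ((p * ½ , M₂) ∷ [])) (num j) ⟩
      mass (steps k ((p * ½ , M₁) ∷ [])) (num j) + mass (steps k ((p * ½ , M₂) ∷ [])) (num j)
        ≡⟨ cong₂ _+_ (lim₁ k le₁ (p * ½)) (lim₂ k le₂ (p * ½)) ⟩
      p * ½ * x₁ + p * ½ * x₂
        ≡⟨ cong₂ _+_ (ℚₚ.*-assoc p ½ x₁) (ℚₚ.*-assoc p ½ x₂) ⟩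
      p * (½ * x₁) + p * (½ * x₂)
        ≡⟨ sym (ℚₚ.*-distribˡ-+ p (½ * x₁) (½ * x₂)) ⟩
      p * (½ * x₁ + ½ * x₂) ∎

  -- The reduction tree is finite, so the mass of `num j` is exactly constant from some step on;
  -- with `leaf` as continuation, the denotation computes that constant.
  eventual-mass : ∀ {M c} → Comp IsNum M c → Eventual M (c leaf)
  eventual-mass (ret {d = n} (_ , refl) e) =
    transport (Eventual (num n)) (sym (e leaf)) (eventual-num n)
  eventual-mass (det s m)                  = eventual-det s (eventual-mass m)
  eventual-mass {M} (flip _ s m₁ m₂ e)     =
    transport (Eventual M) (sym (e leaf)) (eventual-flip s (eventual-mass m₁) (eventual-mass m₂))

eventually-constant⇒converges : ∀ {a q} K → (∀ k → K ≤ k → a k ≡ q) → Converges a q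
eventually-constant⇒converges {a} {q} K const ε 0<ε = K , close-enough
  where
  close-enough : ∀ k → K ≤ k → ∣ a k - q ∣ ℚ.< ε
  close-enough k K≤k rewrite const k K≤k | ℚₚ.+-inverseʳ q = 0<ε

-- The System T programs for probability and bound

numeral : ∀ {b Γ} → ℕ → Tm b Γ Nat
numeral zero    = ze
numeral (suc n) = su ∙ numeral n

-- Erasure and denotation are paired so that a single transport replaces both at once.
denotes-numeral : ∀ n → (erase (numeral {false} {[]} n) , eval (numeral n) tt) ≡ (num n , n)
denotes-numeral zero    = refl
denotes-numeral (suc n) = cong (λ (N , i) → sucT · N , suc i) (denotes-numeral n)

adequacy-Nat : (t : Tm false [] Nat) → EvalsTo (erase t) (num (eval t tt))
adequacy-Nat t with adequacy t
... | _ , ev , refl = ev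

adequacy-BIN : (t : Tm false [] BIN) → let (m , e) = eval t tt in
               EvalsTo (erase t) (pair (num m) (num e))
adequacy-BIN t with adequacy t
... | _ , ev , _ , _ , refl , (_ , refl) , (_ , refl) = ev

-- The translated program yields a function, which the inner continuation applies to the input with
-- `leafT` as final continuation; the resulting answer is then queried at the output.
probabilityT : Tm false [] (Cps ⌈ Nat ⇒ Nat ⌉ ⇒ Nat ⇒ Nat ⇒ BIN)
probabilityT = ƛ (ƛ (ƛ (fst ∙ (v2 ∙ ƛ (v0 ∙ v2 ∙ leafT)) ∙ v0)))

boundT : Tm false [] (Cps ⌈ Nat ⇒ Nat ⌉ ⇒ Nat ⇒ Nat)
boundT = ƛ (ƛ (snd ∙ (v1 ∙ ƛ (v0 ∙ v1 ∙ leafT))))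

module _ (t : Tm true [] (Nat ⇒ Nat)) where

  answer : ℕ → ⟦ Ans ⟧
  answer n = eval (cps t) tt (λ f → f n leaf)

  probability : ℕ → ℕ → ℚ
  probability n k = dyadic (proj₁ (proj₁ (answer n) k)) (proj₂ (proj₁ (answer n) k))

  F : Tm false [] (Nat ⇒ Nat ⇒ BIN)
  F = probabilityT ∙ cps t

  Q : Tm false [] (Nat ⇒ Nat)
  Q = boundT ∙ cps t

  F-evaluates : ∀ n k → let (m , e) = proj₁ (answer n) k in
                EvalsTo (erase F · num n · num k) (pair (num m) (num e))
  F-evaluates n k = subst₂
    (λ (N , i) (K , j) → let (m , e) = proj₁ (answer i) j in
      EvalsTo (erase F · N · K) (pair (num m) (num e)))
    (denotes-numeral n) (denotes-numeral k) (adequacy-BIN (F ∙ numeral n ∙ numeral k))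

  Q-evaluates : ∀ n → EvalsTo (erase Q · num n) (num (proj₂ (answer n)))
  Q-evaluates n = transport
    (λ (N , i) → EvalsTo (erase Q · N) (num (proj₂ (answer i))))
    (denotes-numeral n) (adequacy-Nat (Q ∙ numeral n))

  comp-answer : ∀ n → Comp IsNum (erase t · num n) (λ κ → eval (cps t) tt (λ f → f n κ))
  comp-answer n = comp-app
    (transport (λ M → Comp (Rel (Nat ⇒ Nat)) M (eval (cps t) tt)) (close-erase (λ _ → zeroT) t)
      (cps-fundamental t (λ _ _ _ → refl) λ ()))
    (ret {c = λ κ → κ n} (num-value n , refl) λ κ → refl)

  evalProb-answer : ∀ n k → EvalProb (erase t · num n) (num k) (probability n k) ×
                            (proj₂ (answer n) ≤ k → probability n k ≡ 0ℚ)
  evalProb-answer n k = from-eventual (eventual-mass k (comp-answer n))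
    where
    from-eventual : ∀ {M r} → Eventual k M r → let (m , e) = proj₁ r k in
      EvalProb M (num k) (dyadic m e) × (proj₂ r ≤ k → dyadic m e ≡ 0ℚ)
    from-eventual {M} {r} (x , represents prob vanish , K , lim) =
      -- Weight 1 is that of the initial Dirac distribution.
      eventually-constant⇒converges K (λ i K≤i →
        trans (cong (λ d → mass d (num k)) (μ≡steps M i))
          (trans (lim i K≤i 1ℚ) (trans (ℚₚ.*-identityˡ x) (sym prob)))) ,
      λ le → trans prob (vanish le)

mainTheorem5 : (M : Term) → [] ⊢ M ∶ Nat ⇒ Nat →
    ∃[ F ] ∃[ Q ] (SystemT F × SystemT Q
    × [] ⊢ F ∶ Nat ⇒ Nat ⇒ BIN × [] ⊢ Q ∶ Nat ⇒ Nat
    × (∀ n →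
    (∀ k → ∃[ m ] ∃[ e ]
    (EvalsTo (F · num n · num k) (pair (num m) (num e))
    × EvalProb (M · num n) (num k) (dyadic m e)))
    × ∃[ q ] (EvalsTo (Q · num n) (num q)
    × (∀ k → q ≤ k → ∃[ m ] ∃[ e ]
    (EvalsTo (F · num n · num k) (pair (num m) (num e))
    × dyadic m e ≡ 0ℚ)))))
mainTheorem5 M D =
  erase (F t) , erase (Q t) , erase-systemT (F t) , erase-systemT (Q t) ,
  ⊢erase (F t) , ⊢erase (Q t) , λ n →
    (λ k → _ , _ , F-evaluates t n k ,
      transport (λ M → EvalProb (M · num n) (num k) (probability t n k)) (erase-elaborate D)
        (proj₁ (evalProb-answer t n k))) ,
    _ , Q-evaluates t n ,
    λ k q≤k → _ , _ , F-evaluates t n k , proj₂ (evalProb-answer t n k) q≤k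
  where
  t : Tm true [] (Nat ⇒ Nat)
  t = elaborate D
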